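{- Let $n\ge 1$ be an integer. Then $D_{1,n,2}$ is a $\mathsf{TS}_2$-graph if and only if $n=3$.
   Context: Graphs are finite, simple and undirected. For a graph $G$, $\mathsf{TS}_2(G)$ is the graph whose nodes are all size-2 independent sets of $G$, two nodes $I,J$ being adjacent if there are vertices $u,v$ of $G$ with $I\setminus J=\{u\}$, $J\setminus I=\{v\}$ and $uv\in E(G)$. A graph is a $\mathsf{TS}_2$-graph if it is isomorphic to $\mathsf{TS}_2(G)$ for some graph $G$. For integers $n,r,s\ge 1$, $D_{r,n,s}$ is the tree obtained from the path $P_n$ on $n$ vertices by attaching $r$ leaves to one end vertex and $s$ leaves to the other end vertex (for $n=1$ both ends are the same vertex, so $D_{r,1,s}=K_{1,r+s}$). -}

module Defs where

open import Data.Fin using (Fin; toℕ)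
open import Data.Fin.Properties using (any?)
open import Data.Fin.Subset using (Subset; _∈_; _─_; ⁅_⁆; ∣_∣)
open import Data.Fin.Subset.Properties using (x∈⁅x⁆; x∈⁅y⁆⇒x≡y)
open import Data.Bool.Properties using () renaming (_≟_ to _≟ᵇ_)
open import Data.Nat using (ℕ; suc)
open import Data.Nat.Properties using (1+n≢n) renaming (_≟_ to _≟ⁿ_)
open import Data.Product using (Σ-syntax; ∃-syntax; _×_; _,_)
open import Data.Sum using (inj₁; inj₂)
open import Data.Refinement using (Refinement-syntax; value)
open import Data.Vec.Properties using (≡-dec)
open import Function.Bundles using (_↔_; _⇔_; Inverse)
open import Relation.Binary.Construct.Closure.Symmetric
  using (SymClosure; fwd; bwd; symmetric)
open import Relation.Binary.Core using (Rel)
open import Relation.Binary.Definitions using (Symmetric; Irreflexive; Decidable)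
open import Relation.Binary.PropositionalEquality using (_≡_; refl; sym; trans; subst)
open import Relation.Nullary using (¬_; yes; no; _×-dec_; _⊎-dec_; map′)
open import Level using (0ℓ)

-- Simple undirected graphs; a finite graph is a `SimpleGraph (Fin n)`, up to
-- isomorphism.  Adjacency is decidable because the graphs are finite objects.
record SimpleGraph (V : Set) : Set₁ where
  infix 4 _~_
  field
    _~_      : Rel V 0ℓ
    ~-sym    : Symmetric _~_
    ~-irrefl : Irreflexive _≡_ _~_
    _~?_     : Decidable _~_

infix 4 _≅_

record _≅_ {V W : Set} (G : SimpleGraph V) (H : SimpleGraph W) : Set where
  private
    module G = SimpleGraph G
    module H = SimpleGraph H
  field
    bijection : V ↔ W
  open Inverse bijection using (to) public
  field
    adjacency : ∀ x y → x G.~ y ⇔ to x H.~ to y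

module _ {n : ℕ} (G : SimpleGraph (Fin n)) where
  open SimpleGraph G

  Independent : Subset n → Set
  Independent I = ∀ {u v} → u ∈ I → v ∈ I → ¬ u ~ v

  -- The proof component of a refinement is irrelevant, so two nodes are
  -- propositionally equal as soon as their underlying sets are.
  TS₂-Node : Set
  TS₂-Node = [ I ∈ Subset n ∣ (∣ I ∣ ≡ 2 × Independent I) ]

  Slide : Rel (Subset n) 0ℓ
  Slide I J = ∃[ u ] ∃[ v ] I ─ J ≡ ⁅ u ⁆ × J ─ I ≡ ⁅ v ⁆ × u ~ v

  private
    slide-irrefl : ∀ {I} → ¬ Slide I I
    slide-irrefl (u , v , p , q , u~v) =
      ~-irrefl (x∈⁅y⁆⇒x≡y v (subst (u ∈_) (trans (sym p) q) (x∈⁅x⁆ u))) u~v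

  TS₂ : SimpleGraph TS₂-Node
  TS₂ = record
    { _~_      = λ I J → Slide (value I) (value J)
    ; ~-sym    = λ (u , v , p , q , u~v) → v , u , q , p , ~-sym u~v
    ; ~-irrefl = λ { refl → slide-irrefl }
    ; _~?_     = λ I J → any? λ u → any? λ v →
        ≡-dec _≟ᵇ_ (value I ─ value J) ⁅ u ⁆ ×-dec
        ≡-dec _≟ᵇ_ (value J ─ value I) ⁅ v ⁆ ×-dec (u ~? v)
    }

IsTS₂Graph : {V : Set} → SimpleGraph V → Set₁
IsTS₂Graph H = Σ[ n ∈ ℕ ] Σ[ G ∈ SimpleGraph (Fin n) ] TS₂ G ≅ H

data DVertex (r n s : ℕ) : Set where
  leafˡ : Fin r → DVertex r n s
  path  : Fin n → DVertex r n s
  leafʳ : Fin s → DVertex r n s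

-- Each edge of D r n s in one orientation.
data DArc {r n s : ℕ} : Rel (DVertex r n s) 0ℓ where
  attachˡ : ∀ {a i} → toℕ i ≡ 0 → DArc (leafˡ a) (path i)
  step    : ∀ {i j} → toℕ j ≡ suc (toℕ i) → DArc (path i) (path j)
  attachʳ : ∀ {i b} → suc (toℕ i) ≡ n → DArc (path i) (leafʳ b)

private
  variable
    r n s : ℕ

  arc? : Decidable (DArc {r} {n} {s})
  arc? (leafˡ _) (leafˡ _) = no λ ()
  arc? (leafˡ _) (path i)  = map′ attachˡ (λ { (attachˡ e) → e }) (toℕ i ≟ⁿ 0)
  arc? (leafˡ _) (leafʳ _) = no λ ()
  arc? (path _)  (leafˡ _) = no λ ()
  arc? (path i)  (path j)  = map′ step (λ { (step e) → e }) (toℕ j ≟ⁿ suc (toℕ i))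
  arc? {n = n} (path i) (leafʳ _) =
    map′ attachʳ (λ { (attachʳ e) → e }) (suc (toℕ i) ≟ⁿ n)
  arc? (leafʳ _) _         = no λ ()

  arc-irrefl : {x : DVertex r n s} → ¬ DArc x x
  arc-irrefl (step e) = 1+n≢n (sym e)

-- Meaningful for n ≥ 1 only: the path on 0 vertices has no ends.
D : (r n s : ℕ) → SimpleGraph (DVertex r n s)
D r n s = record
  { _~_      = SymClosure DArc
  ; ~-sym    = symmetric DArc
  ; ~-irrefl = λ { refl (fwd a) → arc-irrefl a ; refl (bwd a) → arc-irrefl a }
  ; _~?_     = λ x y → map′ (λ { (inj₁ a) → fwd a ; (inj₂ a) → bwd a })
                             (λ { (fwd a) → inj₁ a ; (bwd a) → inj₂ a })
                             (arc? x y ⊎-dec arc? y x)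
  }

{-# OPTIONS --safe #-}
module Submission where

-- Let H be the complement of G.  Nodes of TS₂ G are edges of H, written ⟨ a≁b ⟩, and two of
-- them are adjacent iff they form an induced path on three vertices of H (TS₂ G is the Gallai
-- graph of H).  Let xy be the edge of H that is the degree-3 node of D 1 n 2.  Two of its three
-- neighbours meet it at the same end x, say xu and xv, and as they are not adjacent, uv is an edge
-- of H.  It needs a neighbour, say uz with z and v nonadjacent in H.  If xz is not an edge of H,
-- then xy, xu, uz, uv is a path whose last node has no further neighbour, so n = 3; if it is,
-- every position of the third neighbour of xy violates a degree condition of the tree.

open import Defs
open import Data.Bool.Properties using () renaming (_≟_ to _≟ᵇ_)
open import Data.Empty using (⊥; ⊥-elim-irr)
open import Data.Fin using (Fin; zero; suc; toℕ; fromℕ; fromℕ<; #_; _↑ˡ_; _↑ʳ_)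
open import Data.Fin.Properties
  using (all?; any?; toℕ<n; toℕ-injective; toℕ-fromℕ; toℕ-fromℕ<) renaming (_≟_ to _≟ᶠ_)
open import Data.Fin.Subset using (Subset; _∈_; _∉_; _⊆_; _─_; _∪_; ⁅_⁆; ∣_∣; inside; outside)
  renaming (⊥ to ∅)
open import Data.Fin.Subset.Properties
  using (_∈?_; x∈⁅x⁆; x∈⁅y⁆⇒x≡y; ∣⁅x⁆∣≡1; ∪-identityˡ; ∪-identityʳ; ∪-comm; ⊆-antisym;
         x∈p∪q⁻; x∈p∪q⁺; p─q⊆p; x∈p∧x∉q⇒x∈p─q)
open import Data.Irrelevant using ([_])
open import Data.Nat using (ℕ; zero; suc; _≤_; z≤n; s≤s)
open import Data.Nat.Properties
  using (suc-injective; ≤-refl; ≤-reflexive; ≤-trans; ≤-pred; <⇒≤; n≤1+n; 1+n≰n; m≤n+m;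
         m≢1+n+m; m≤n⇒m<n∨m≡n) renaming (_≟_ to _≟ⁿ_)
open import Data.Product using (Σ-syntax; ∃-syntax; _×_; _,_; proj₁; proj₂)
open import Data.Refinement using (value; _,_)
open import Data.Sum using (_⊎_; inj₁; inj₂; [_,_]′; swap)
open import Data.Vec using (_∷_; []; here; there)
open import Data.Vec.Properties using (≡-dec)
open import Function.Base using (_∘_)
open import Function.Bundles using (_⇔_; mk⇔; mk↔ₛ′; Equivalence; Inverse)
open import Relation.Binary.Construct.Closure.Symmetric using (fwd; bwd)
open import Relation.Binary.Definitions using (DecidableEquality)
open import Relation.Binary.PropositionalEquality
  using (_≡_; _≢_; refl; sym; trans; cong; subst; subst₂; ≢-sym)
open import Relation.Nullary
  using (¬_; Dec; yes; no; contradiction; recompute; map′; from-yes; ¬?; _×-dec_; _→-dec_)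

private
  variable
    k : ℕ
    V : Set

-- Collects what the contradiction uses about `D 1 n 2` with `n ≢ 3` near its degree-3 vertex `c`,
-- so that the argument inside `TS₂ G` never mentions the tree.
record Forked (K : SimpleGraph V) (c : V) : Set where
  open SimpleGraph K

  Leaf : V → Set
  Leaf x = ∀ z → x ~ z → z ≡ c

  field
    {n₁ n₂ n₃}  : V
    c~n₁        : c ~ n₁
    c~n₂        : c ~ n₂
    c~n₃        : c ~ n₃
    n₁≢n₂       : n₁ ≢ n₂
    n₁≢n₃       : n₁ ≢ n₃
    n₂≢n₃       : n₂ ≢ n₃
    leaf        : ∀ {x y} → c ~ x → c ~ y → x ≢ y → Leaf x ⊎ Leaf y
    nonisolated : ∀ x → ∃[ y ] x ~ y
    degree≥3    : ∀ {x p q r} → x ~ p → x ~ q → x ~ r →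
                  p ≢ q → p ≢ r → q ≢ r → x ≡ c
    -- For D 1 n 2 this is the one field that fails at n = 3.
    extend      : ∀ {p q r} → c ~ p → p ~ q → q ≢ c → q ~ r → r ≢ p →
                  ∃[ s ] r ~ s × s ≢ q

-- Two-element subsets.

pair : Fin k → Fin k → Subset k
pair a b = ⁅ a ⁆ ∪ ⁅ b ⁆

module _ {a b x : Fin k} where

  ∈pair⁻ : x ∈ pair a b → x ≡ a ⊎ x ≡ b
  ∈pair⁻ x∈ with x∈p∪q⁻ ⁅ a ⁆ ⁅ b ⁆ x∈
  ... | inj₁ x∈a = inj₁ (x∈⁅y⁆⇒x≡y a x∈a)
  ... | inj₂ x∈b = inj₂ (x∈⁅y⁆⇒x≡y b x∈b)

  ∈pair⁺ : x ≡ a ⊎ x ≡ b → x ∈ pair a b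
  ∈pair⁺ (inj₁ refl) = x∈p∪q⁺ (inj₁ (x∈⁅x⁆ x))
  ∈pair⁺ (inj₂ refl) = x∈p∪q⁺ {p = ⁅ a ⁆} (inj₂ (x∈⁅x⁆ x))

∣pair∣≡2 : {a b : Fin k} → a ≢ b → ∣ pair a b ∣ ≡ 2
∣pair∣≡2 {a = zero}  {zero}  a≢b = contradiction refl a≢b
∣pair∣≡2 {a = zero}  {suc b} _
  rewrite ∪-identityˡ ⁅ b ⁆ = cong suc (∣⁅x⁆∣≡1 b)
∣pair∣≡2 {a = suc a} {zero}  _
  rewrite ∪-identityʳ ⁅ a ⁆ = cong suc (∣⁅x⁆∣≡1 a)
∣pair∣≡2 {a = suc a} {suc b} a≢b = ∣pair∣≡2 (a≢b ∘ cong suc)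

∣p∣≡0⇒p≡∅ : (p : Subset k) → ∣ p ∣ ≡ 0 → p ≡ ∅
∣p∣≡0⇒p≡∅ []            _ = refl
∣p∣≡0⇒p≡∅ (outside ∷ p) e = cong (outside ∷_) (∣p∣≡0⇒p≡∅ p e)

∣p∣≡1⇒singleton : (p : Subset k) → ∣ p ∣ ≡ 1 → ∃[ a ] p ≡ ⁅ a ⁆
∣p∣≡1⇒singleton (inside ∷ p) e =
  zero , cong (inside ∷_) (∣p∣≡0⇒p≡∅ p (suc-injective e))
∣p∣≡1⇒singleton (outside ∷ p) e with a , refl ← ∣p∣≡1⇒singleton p e =
  suc a , refl

∣p∣≡2⇒pair : (p : Subset k) → ∣ p ∣ ≡ 2 →
             ∃[ a ] ∃[ b ] a ≢ b × p ≡ pair a b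
∣p∣≡2⇒pair (inside ∷ p) e
  with b , refl ← ∣p∣≡1⇒singleton p (suc-injective e) =
  zero , suc b , (λ ()) , cong (inside ∷_) (sym (∪-identityˡ ⁅ b ⁆))
∣p∣≡2⇒pair (outside ∷ p) e with a , b , a≢b , refl ← ∣p∣≡2⇒pair p e =
  suc a , suc b , (λ { refl → a≢b refl }) , refl

x∈p─q⇒x∉q : {x : Fin k} (p q : Subset k) → x ∈ p ─ q → x ∉ q
x∈p─q⇒x∉q (_ ∷ p) (_ ∷ q) (there x∈) (there x∈q) = x∈p─q⇒x∉q p q x∈ x∈q
x∈p─q⇒x∉q (_ ∷ p) (inside ∷ q) () here

pair─pair : {a b c : Fin k} → b ≢ a → b ≢ c → pair a b ─ pair a c ≡ ⁅ b ⁆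
pair─pair {a = a} {b} {c} b≢a b≢c = ⊆-antisym forward backward
  where
  forward : pair a b ─ pair a c ⊆ ⁅ b ⁆
  forward {x} x∈ with ∈pair⁻ (p─q⊆p (pair a b) (pair a c) x∈)
  ... | inj₁ x≡a = contradiction (∈pair⁺ (inj₁ x≡a)) (x∈p─q⇒x∉q (pair a b) _ x∈)
  ... | inj₂ refl = x∈⁅x⁆ x

  backward : ⁅ b ⁆ ⊆ pair a b ─ pair a c
  backward x∈ with refl ← x∈⁅y⁆⇒x≡y b x∈ =
    x∈p∧x∉q⇒x∈p─q (∈pair⁺ (inj₂ refl)) ([ b≢a , b≢c ]′ ∘ ∈pair⁻)

-- Only `b` leaves `I`, so `a` stays in `J`; only `v` enters, so `J` has no other element.
exchange : {I J : Subset k} {a b u v : Fin k} → a ≢ b → u ≡ b →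
           I ≡ pair a b → I ─ J ≡ ⁅ u ⁆ → J ─ I ≡ ⁅ v ⁆ →
           a ≢ v × a ∈ J × v ∈ J × J ≡ pair a v
exchange {I = I} {J} {a} {b} {v = v} a≢b refl refl I─J J─I =
  (λ { refl → v∉I a∈I }) , a∈J , v∈J , ⊆-antisym forward backward
  where
  v∈J─I : v ∈ J ─ I
  v∈J─I = subst (v ∈_) (sym J─I) (x∈⁅x⁆ v)

  v∈J : v ∈ J
  v∈J = p─q⊆p J I v∈J─I

  v∉I : v ∉ I
  v∉I = x∈p─q⇒x∉q J I v∈J─I

  a∈I : a ∈ I
  a∈I = ∈pair⁺ (inj₁ refl)

  b∉J : b ∉ J
  b∉J = x∈p─q⇒x∉q I J (subst (b ∈_) (sym I─J) (x∈⁅x⁆ b))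

  a∈J : a ∈ J
  a∈J with a ∈? J
  ... | yes a∈J = a∈J
  ... | no  a∉J = contradiction
    (x∈⁅y⁆⇒x≡y b (subst (a ∈_) I─J (x∈p∧x∉q⇒x∈p─q a∈I a∉J))) a≢b

  forward : J ⊆ pair a v
  forward {x} x∈J with x ∈? I
  ... | no  x∉I =
    ∈pair⁺ (inj₂ (x∈⁅y⁆⇒x≡y v (subst (x ∈_) J─I (x∈p∧x∉q⇒x∈p─q x∈J x∉I))))
  ... | yes x∈I with ∈pair⁻ x∈I
  ...   | inj₁ x≡a  = ∈pair⁺ (inj₁ x≡a)
  ...   | inj₂ refl = contradiction x∈J b∉J

  backward : pair a v ⊆ J
  backward x∈ with ∈pair⁻ x∈
  ... | inj₁ refl = a∈J
  ... | inj₂ refl = v∈J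

-- Nodes of `TS₂ G` as edges of the complement.

module _ {n : ℕ} {G : SimpleGraph (Fin n)} where
  open SimpleGraph G

  infix 4 _≁_

  _≁_ : Fin n → Fin n → Set
  a ≁ b = a ≢ b × ¬ a ~ b

  ≁-sym : ∀ {a b} → a ≁ b → b ≁ a
  ≁-sym (a≢b , ¬a~b) = ≢-sym a≢b , ¬a~b ∘ ~-sym

  ~⇒≢ : ∀ {a b} → a ~ b → a ≢ b
  ~⇒≢ a~b a≡b = ~-irrefl a≡b a~b

  ~-or-≁ : ∀ {a b} → a ≢ b → a ~ b ⊎ a ≁ b
  ~-or-≁ {a} {b} a≢b with a ~? b
  ... | yes a~b = inj₁ a~b
  ... | no ¬a~b = inj₂ (a≢b , ¬a~b)

  separates : ∀ {a b c} → a ~ b → a ≁ c → b ≢ c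
  separates a~b (_ , ¬a~c) refl = ¬a~c a~b

  pair-independent : ∀ {a b} → a ≁ b → Independent G (pair a b)
  pair-independent (_ , ¬a~b) u∈ v∈ u~v with ∈pair⁻ u∈ | ∈pair⁻ v∈
  ... | inj₁ refl | inj₁ refl = ~-irrefl refl u~v
  ... | inj₁ refl | inj₂ refl = ¬a~b u~v
  ... | inj₂ refl | inj₁ refl = ¬a~b (~-sym u~v)
  ... | inj₂ refl | inj₂ refl = ~-irrefl refl u~v

  ⟨_⟩ : ∀ {a b} → a ≁ b → TS₂-Node G
  ⟨_⟩ {a} {b} a≁b = pair a b , [ ∣pair∣≡2 (proj₁ a≁b) , pair-independent a≁b ]

  node-≡ : {I J : TS₂-Node G} → value I ≡ value J → I ≡ J
  node-≡ refl = refl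

  ⟨⟩-sym : ∀ {a b} (a≁b : a ≁ b) → ⟨ a≁b ⟩ ≡ ⟨ ≁-sym a≁b ⟩
  ⟨⟩-sym {a} {b} _ = node-≡ (∪-comm ⁅ a ⁆ ⁅ b ⁆)

  ⟨⟩-end : ∀ {a b c d} (a≁b : a ≁ b) (c≁d : c ≁ d) →
           ⟨ a≁b ⟩ ≡ ⟨ c≁d ⟩ → a ≡ c ⊎ a ≡ d
  ⟨⟩-end _ _ e = ∈pair⁻ (subst (_ ∈_) (cong value e) (∈pair⁺ (inj₁ refl)))

  ⟨⟩-≢ : ∀ {a b c d} (a≁b : a ≁ b) (c≁d : c ≁ d) →
         a ≢ c → a ≢ d → ⟨ a≁b ⟩ ≢ ⟨ c≁d ⟩
  ⟨⟩-≢ a≁b c≁d a≢c a≢d = [ a≢c , a≢d ]′ ∘ ⟨⟩-end a≁b c≁d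

  ⟨⟩-cancelˡ : ∀ {a b c} (a≁b : a ≁ b) (a≁c : a ≁ c) →
               ⟨ a≁b ⟩ ≡ ⟨ a≁c ⟩ → b ≡ c
  ⟨⟩-cancelˡ a≁b a≁c e
    with ⟨⟩-end (≁-sym a≁b) a≁c (trans (sym (⟨⟩-sym a≁b)) e)
  ... | inj₁ b≡a = contradiction (sym b≡a) (proj₁ a≁b)
  ... | inj₂ b≡c = b≡c

  -- The proof component of a node is irrelevant. It can be used here because the goal is a
  -- negation, and for the cardinality below because equality on `ℕ` is decidable.
  independent : (I : TS₂-Node G) → Independent G (value I)
  independent (_ , [ p ]) u∈ v∈ u~v = ⊥-elim-irr (proj₂ p u∈ v∈ u~v)

  ∣node∣≡2 : (I : TS₂-Node G) → ∣ value I ∣ ≡ 2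
  ∣node∣≡2 (I , [ p ]) = recompute (∣ I ∣ ≟ⁿ 2) (proj₁ p)

  ⟨⟩-surjective : (I : TS₂-Node G) → ∃[ a ] ∃[ b ] Σ[ a≁b ∈ a ≁ b ] I ≡ ⟨ a≁b ⟩
  ⟨⟩-surjective I with a , b , a≢b , e ← ∣p∣≡2⇒pair (value I) (∣node∣≡2 I) =
    a , b , (a≢b , independent I (a∈ (inj₁ refl)) (a∈ (inj₂ refl))) , node-≡ e
    where
    a∈ : ∀ {x} → x ≡ a ⊎ x ≡ b → x ∈ value I
    a∈ = subst (_ ∈_) (sym e) ∘ ∈pair⁺

  open SimpleGraph (TS₂ G) using () renaming (_~_ to infix 4 _∼_)

  slideˡ : ∀ {a b c} (a≁b : a ≁ b) (a≁c : a ≁ c) → b ~ c → ⟨ a≁b ⟩ ∼ ⟨ a≁c ⟩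
  slideˡ (a≢b , _) (a≢c , _) b~c =
    _ , _ , pair─pair (≢-sym a≢b) (~⇒≢ b~c)
          , pair─pair (≢-sym a≢c) (≢-sym (~⇒≢ b~c)) , b~c

  slideʳ : ∀ {a b c} (a≁b : a ≁ b) (b≁c : b ≁ c) → a ~ c → ⟨ a≁b ⟩ ∼ ⟨ b≁c ⟩
  slideʳ a≁b b≁c a~c =
    subst (_∼ ⟨ b≁c ⟩) (sym (⟨⟩-sym a≁b)) (slideˡ (≁-sym a≁b) b≁c a~c)

  -- These are the neighbours of the node `ab` that keep `a`: in the complement, `b`, `a`, `t` is an
  -- induced path.
  Spoke : Fin n → Fin n → TS₂-Node G → Set
  Spoke a b J = ∃[ t ] Σ[ a≁t ∈ a ≁ t ] b ~ t × J ≡ ⟨ a≁t ⟩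

  spoke : ∀ {a b} (a≁b : a ≁ b) {J} → ⟨ a≁b ⟩ ∼ J → Spoke a b J ⊎ Spoke b a J
  spoke {a} {b} a≁b {J} (u , v , I─J , J─I , u~v)
    with ∈pair⁻ (p─q⊆p (pair a b) (value J) (subst (u ∈_) (sym I─J) (x∈⁅x⁆ u)))
  ... | inj₂ refl with a≢v , a∈J , v∈J , J≡ ← exchange (proj₁ a≁b) refl refl I─J J─I =
    inj₁ (v , (a≢v , independent J a∈J v∈J) , u~v , node-≡ J≡)
  ... | inj₁ refl
    with b≢v , b∈J , v∈J , J≡ ← exchange (≢-sym (proj₁ a≁b)) refl (∪-comm ⁅ a ⁆ ⁅ b ⁆) I─J J─I =
    inj₂ (v , (b≢v , independent J b∈J v∈J) , u~v , node-≡ J≡)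

  -- Neighbours of the centre `xy` that share its end `x`.

  module _ {x y} (x≁y : x ≁ y) (F : Forked (TS₂ G) ⟨ x≁y ⟩) where
    open Forked F

    module _ {u} (x≁u : x ≁ u) (y~u : y ~ u) where

      centre∼ : ⟨ x≁y ⟩ ∼ ⟨ x≁u ⟩
      centre∼ = slideˡ x≁y x≁u y~u

      -- The node `xu` slides to `xt`, which for a leaf can only be `xy`.
      leaf-inner : Leaf ⟨ x≁u ⟩ → ∀ {t} → x ≁ t → u ~ t → t ≡ y
      leaf-inner ℓ x≁t u~t = ⟨⟩-cancelˡ x≁t x≁y (ℓ _ (slideˡ x≁u x≁t u~t))

      -- Otherwise `xu` slides to `ut`, which is not `xy` since `u` is neither `x` nor `y`.
      leaf-outer : Leaf ⟨ x≁u ⟩ → ∀ {t} → u ≁ t → ¬ x ~ t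
      leaf-outer ℓ u≁t x~t =
        ⟨⟩-≢ u≁t x≁y (≢-sym (proj₁ x≁u)) (≢-sym (~⇒≢ y~u)) (ℓ _ (slideʳ x≁u u≁t x~t))

    module _ {u v} (x≁u : x ≁ u) (y~u : y ~ u) (x≁v : x ≁ v) (y~v : y ~ v) where

      -- If `x ~ t`, the leaf `xu` slides to `ut`. If not, the leaf `xv` slides to `xt`, so `t` is
      -- `y`, against `y ~ u` and `u ≁ t`.
      leaves-unslid : Leaf ⟨ x≁u ⟩ → Leaf ⟨ x≁v ⟩ → ∀ {t} → u ≁ t → ¬ v ~ t
      leaves-unslid ℓu ℓv {t} u≁t v~t with ~-or-≁ {x} {t} (≢-sym (separates v~t (≁-sym x≁v)))
      ... | inj₁ x~t = leaf-outer x≁u y~u ℓu u≁t x~t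
      ... | inj₂ x≁t = separates (~-sym y~u) u≁t (sym (leaf-inner x≁v y~v ℓv x≁t v~t))

      -- If `u ~ v`, then `xy`, `xu`, `xv` form a triangle, although `leaf` makes `xu` or `xv` a
      -- leaf.
      spokes-apart : u ≢ v → u ≁ v
      spokes-apart u≢v with ~-or-≁ u≢v
      ... | inj₂ u≁v = u≁v
      ... | inj₁ u~v
        with leaf (centre∼ x≁u y~u) (centre∼ x≁v y~v) (u≢v ∘ ⟨⟩-cancelˡ x≁u x≁v)
      ...   | inj₁ ℓu = contradiction (sym (leaf-inner x≁u y~u ℓu x≁v u~v)) (~⇒≢ y~v)
      ...   | inj₂ ℓv =
        contradiction (sym (leaf-inner x≁v y~v ℓv x≁u (~-sym u~v))) (~⇒≢ y~u)

    -- The node `uv` has a neighbour, but `leaves-unslid` excludes both the slides that keep `u` and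
    -- those that keep `v`.
    leaves-not-at-one-end : ∀ {u v} (x≁u : x ≁ u) → y ~ u → (x≁v : x ≁ v) → y ~ v → u ≁ v →
                            Leaf ⟨ x≁u ⟩ → ¬ Leaf ⟨ x≁v ⟩
    leaves-not-at-one-end x≁u y~u x≁v y~v u≁v ℓu ℓv
      with J , uv∼J ← nonisolated ⟨ u≁v ⟩ | spoke u≁v {J} uv∼J
    ... | inj₁ (_ , u≁t , v~t , _) = leaves-unslid x≁u y~u x≁v y~v ℓu ℓv u≁t v~t
    ... | inj₂ (_ , v≁t , u~t , _) = leaves-unslid x≁v y~v x≁u y~u ℓv ℓu v≁t u~t

    -- A neighbour `uz` of `uv`, and the third neighbour of `xy`.

    module _ {u v z} (x≁u : x ≁ u) (y~u : y ~ u) (x≁v : x ≁ v) (y~v : y ~ v)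
             (u≁v : u ≁ v) (u≁z : u ≁ z) (v~z : v ~ z) where

      private
        x≢z : x ≢ z
        x≢z = ≢-sym (separates v~z (≁-sym x≁v))

        y≢z : y ≢ z
        y≢z = separates (~-sym y~u) u≁z

        xu≢xy : ⟨ x≁u ⟩ ≢ ⟨ x≁y ⟩
        xu≢xy = ≢-sym (~⇒≢ y~u) ∘ ⟨⟩-cancelˡ x≁u x≁y

        xv≢xy : ⟨ x≁v ⟩ ≢ ⟨ x≁y ⟩
        xv≢xy = ≢-sym (~⇒≢ y~v) ∘ ⟨⟩-cancelˡ x≁v x≁y

        u≢x : u ≢ x
        u≢x = ≢-sym (proj₁ x≁u)

        u≢y : u ≢ y
        u≢y = ≢-sym (~⇒≢ y~u)

        spokes-≢ : ⟨ x≁u ⟩ ≢ ⟨ x≁v ⟩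
        spokes-≢ = proj₁ u≁v ∘ ⟨⟩-cancelˡ x≁u x≁v

        xu∼xy : ⟨ x≁u ⟩ ∼ ⟨ x≁y ⟩
        xu∼xy = slideˡ x≁u x≁y (~-sym y~u)

        uz≢xy : ⟨ u≁z ⟩ ≢ ⟨ x≁y ⟩
        uz≢xy = ⟨⟩-≢ u≁z x≁y u≢x u≢y

        uv≢xu : ⟨ u≁v ⟩ ≢ ⟨ x≁u ⟩
        uv≢xu = ⟨⟩-≢ (≁-sym u≁v) x≁u (≢-sym (proj₁ x≁v)) (≢-sym (proj₁ u≁v))
              ∘ trans (sym (⟨⟩-sym u≁v))

      -- If `x ~ z`, then `xy`, `xu`, `uz`, `uv` is a path. As `xu` is no leaf, `xv` is one, and
      -- every further neighbour of `uv` leads to a contradiction.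
      x≁z-forced : ¬ x ~ z
      x≁z-forced x~z
        with leaf (centre∼ x≁u y~u) (centre∼ x≁v y~v) spokes-≢
      ... | inj₁ ℓu = leaf-outer x≁u y~u ℓu u≁z x~z
      ... | inj₂ ℓv
        -- The path may not stop at `uv`; this is the only use of `extend`.
        with J , uv∼J , J≢uz ← extend (centre∼ x≁u y~u) (slideʳ x≁u u≁z x~z) uz≢xy
                                 (slideˡ u≁z u≁v (~-sym v~z)) uv≢xu
        with spoke u≁v {J} uv∼J
      ...   | inj₁ (z′ , u≁z′ , v~z′ , refl)
        with ~-or-≁ {x} {z′} (≢-sym (separates v~z′ (≁-sym x≁v)))
      ...     | inj₁ x~z′ =
        -- The three neighbours `xy`, `uz`, `uz′` would make `xu` the centre.
        xu≢xy (degree≥3 xu∼xy (slideʳ x≁u u≁z x~z) (slideʳ x≁u u≁z′ x~z′)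
                 (≢-sym uz≢xy) (≢-sym (⟨⟩-≢ u≁z′ x≁y u≢x u≢y)) (≢-sym J≢uz))
      ...     | inj₂ x≁z′ = separates (~-sym y~u) u≁z′ (sym (leaf-inner x≁v y~v ℓv x≁z′ v~z′))
      x≁z-forced x~z | inj₂ ℓv | inj₂ (z′ , v≁z′ , u~z′ , refl)
        with ~-or-≁ {x} {z′} (≢-sym (separates u~z′ (≁-sym x≁u)))
      ...     | inj₁ x~z′ = leaf-outer x≁v y~v ℓv v≁z′ x~z′
      ...     | inj₂ x≁z′ =
        -- The same with the neighbours `xy`, `uz`, `xz′`.
        xu≢xy (degree≥3 xu∼xy (slideʳ x≁u u≁z x~z) (slideˡ x≁u x≁z′ u~z′)
                 (≢-sym uz≢xy) (separates (~-sym y~v) v≁z′ ∘ ⟨⟩-cancelˡ x≁y x≁z′)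
                 (⟨⟩-≢ u≁z x≁z′ u≢x (~⇒≢ u~z′)))

      module _ (x≁z : x ≁ z) where

        -- The node `xv` slides to `xz`, and `z` is not `y`. By `leaf`, all other neighbours of the
        -- centre are then leaves.
        xv-branches : ¬ Leaf ⟨ x≁v ⟩
        xv-branches ℓv = y≢z (sym (leaf-inner x≁v y~v ℓv x≁z v~z))

        leaf-other : ∀ {J} → ⟨ x≁y ⟩ ∼ J → J ≢ ⟨ x≁v ⟩ → Leaf J
        leaf-other xy∼J J≢xv with leaf xy∼J (centre∼ x≁v y~v) J≢xv
        ... | inj₁ ℓJ = ℓJ
        ... | inj₂ ℓv = contradiction ℓv xv-branches

        ℓu : Leaf ⟨ x≁u ⟩
        ℓu = leaf-other (centre∼ x≁u y~u) spokes-≢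

        -- If `y ~ z`, then `xz` is a neighbour of the centre other than `xv`, hence a leaf, yet it
        -- is adjacent to `xv`.
        y≁z : y ≁ z
        y≁z with ~-or-≁ y≢z
        ... | inj₂ y≁z = y≁z
        ... | inj₁ y~z = contradiction
          (leaf-other (centre∼ x≁z y~z) (≢-sym (~⇒≢ v~z) ∘ ⟨⟩-cancelˡ x≁z x≁v)
             _ (slideˡ x≁z x≁v (~-sym v~z)))
          xv≢xy

        -- Here `xu` and `xw` would be two leaves at the same end.
        no-third-at-x : ∀ {w} (x≁w : x ≁ w) → y ~ w → ⟨ x≁w ⟩ ≢ ⟨ x≁u ⟩ → ⟨ x≁w ⟩ ≢ ⟨ x≁v ⟩ → ⊥
        no-third-at-x x≁w y~w xw≢xu xw≢xv =
          leaves-not-at-one-end x≁u y~u x≁w y~w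
            (spokes-apart x≁u y~u x≁w y~w λ { refl → xw≢xu refl })
            ℓu (leaf-other (centre∼ x≁w y~w) xw≢xv)

        -- If `z ~ w`, the leaf `yw` slides to `yz`; if `u ≁ w`, the leaf `xu` slides to `uw`. In
        -- the remaining case `uz` has the three neighbours `uv`, `zw`, `zy`.
        no-third-at-y : ∀ {w} (y≁w : y ≁ w) → x ~ w → ⊥
        no-third-at-y {w} y≁w x~w
          with ~-or-≁ {z} {w} (≢-sym (separates x~w x≁z)) | ~-or-≁ {u} {w} (≢-sym (separates x~w x≁u))
        ... | inj₁ z~w | _ = ⟨⟩-≢ (≁-sym y≁z) x≁y (≢-sym x≢z) (≢-sym y≢z)
          (trans (sym (⟨⟩-sym y≁z)) (ℓyw _ (slideˡ y≁w y≁z (~-sym z~w))))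
          where
          ℓyw : Leaf ⟨ y≁w ⟩
          ℓyw = leaf-other (slideʳ x≁y y≁w x~w)
                  (⟨⟩-≢ y≁w x≁v (≢-sym (proj₁ x≁y)) (~⇒≢ y~v))
        ... | inj₂ _   | inj₂ u≁w = leaf-outer x≁u y~u ℓu u≁w x~w
        ... | inj₂ z≁w | inj₁ u~w =
          uz≢xy (degree≥3 (slideˡ u≁z u≁v (~-sym v~z)) (slideʳ u≁z z≁w u~w)
                   (slideʳ u≁z (≁-sym y≁z) (~-sym y~u))
                   (⟨⟩-≢ u≁v z≁w (proj₁ u≁z) (~⇒≢ u~w))
                   (⟨⟩-≢ u≁v (≁-sym y≁z) (proj₁ u≁z) u≢y)
                   (≢-sym (proj₁ y≁w) ∘ ⟨⟩-cancelˡ z≁w (≁-sym y≁z)))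

      no-third : ∀ {J} → Spoke x y J ⊎ Spoke y x J → J ≢ ⟨ x≁u ⟩ → J ≢ ⟨ x≁v ⟩ → ⊥
      no-third J-spoke J≢xu J≢xv with ~-or-≁ x≢z | J-spoke
      ... | inj₁ x~z | _ = x≁z-forced x~z
      ... | inj₂ x≁z | inj₁ (_ , x≁w , y~w , refl) = no-third-at-x x≁z x≁w y~w J≢xu J≢xv
      ... | inj₂ x≁z | inj₂ (_ , y≁w , x~w , refl) = no-third-at-y x≁z y≁w x~w

    -- A neighbour of `uv` keeps `u` or `v`; the second case is the first with `u` and `v`
    -- exchanged.
    two-spokes-at-one-end : ∀ {I J K} → Spoke x y I → Spoke x y J → Spoke x y K ⊎ Spoke y x K →
                            I ≢ J → K ≢ I → K ≢ J → ⊥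
    two-spokes-at-one-end (u , x≁u , y~u , refl) (v , x≁v , y~v , refl) K-spoke I≢J K≢I K≢J
      with u≁v ← spokes-apart x≁u y~u x≁v y~v (λ { refl → I≢J refl })
      with L , uv∼L ← nonisolated ⟨ u≁v ⟩
      with spoke u≁v {L} uv∼L
    ... | inj₁ (_ , u≁z , v~z , _) =
      no-third x≁u y~u x≁v y~v u≁v u≁z v~z K-spoke K≢I K≢J
    ... | inj₂ (_ , v≁z , u~z , _) =
      no-third x≁v y~v x≁u y~u (≁-sym u≁v) v≁z u~z K-spoke K≢J K≢I

  -- By the pigeonhole principle two of the three neighbours of `c` keep the same end; `F′` serves
  -- the case that this end is `y`.
  TS₂-not-forked : ∀ {c} → ¬ Forked (TS₂ G) c
  TS₂-not-forked {c} F with x , y , x≁y , refl ← ⟨⟩-surjective c =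
    go (spoke x≁y {n₁} c~n₁) (spoke x≁y {n₂} c~n₂) (spoke x≁y {n₃} c~n₃)
    where
    open Forked F

    F′ : Forked (TS₂ G) ⟨ ≁-sym x≁y ⟩
    F′ = subst (Forked (TS₂ G)) (⟨⟩-sym x≁y) F

    go : Spoke x y n₁ ⊎ Spoke y x n₁ → Spoke x y n₂ ⊎ Spoke y x n₂ →
         Spoke x y n₃ ⊎ Spoke y x n₃ → ⊥
    go (inj₁ p) (inj₁ q) r =
      two-spokes-at-one-end x≁y F p q r n₁≢n₂ (≢-sym n₁≢n₃) (≢-sym n₂≢n₃)
    go (inj₂ p) (inj₂ q) r =
      two-spokes-at-one-end (≁-sym x≁y) F′ p q (swap r) n₁≢n₂ (≢-sym n₁≢n₃) (≢-sym n₂≢n₃)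
    go (inj₁ p) (inj₂ q) (inj₁ r) =
      two-spokes-at-one-end x≁y F p r (inj₂ q) n₁≢n₃ (≢-sym n₁≢n₂) n₂≢n₃
    go (inj₁ p) (inj₂ q) (inj₂ r) =
      two-spokes-at-one-end (≁-sym x≁y) F′ q r (inj₂ p) n₂≢n₃ n₁≢n₂ n₁≢n₃
    go (inj₂ p) (inj₁ q) (inj₁ r) =
      two-spokes-at-one-end x≁y F q r (inj₂ p) n₂≢n₃ n₁≢n₂ n₁≢n₃
    go (inj₂ p) (inj₁ q) (inj₂ r) =
      two-spokes-at-one-end (≁-sym x≁y) F′ p r (inj₂ q) n₁≢n₃ (≢-sym n₁≢n₂) n₂≢n₃

-- Levels of D r n s: along every edge the level changes by one, and only the
-- end levels 0 and n + 1 can contain more than one vertex.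

pos : {r n s : ℕ} → DVertex r n s → ℕ
pos (leafˡ _)         = 0
pos (path i)          = suc (toℕ i)
pos {n = n} (leafʳ _) = suc n

module _ {r m s : ℕ} where

  arc⇒pos : {x y : DVertex r (suc m) s} → DArc x y → pos y ≡ suc (pos x)
  arc⇒pos (attachˡ e) = cong suc e
  arc⇒pos (step e)    = cong suc e
  arc⇒pos (attachʳ e) = cong suc (sym e)

  pos≤ : (x : DVertex r (suc m) s) → pos x ≤ suc (suc m)
  pos≤ (leafˡ _) = z≤n
  pos≤ (path i)  = s≤s (<⇒≤ (toℕ<n i))
  pos≤ (leafʳ _) = ≤-refl

  -- A nonempty path keeps the left and right leaves off consecutive levels, so adjacency becomes
  -- arithmetic of levels.
  pos⇒arc : {x y : DVertex r (suc m) s} → pos y ≡ suc (pos x) → DArc x y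
  pos⇒arc {leafˡ _} {path i}  e = attachˡ (suc-injective e)
  pos⇒arc {path i}  {path j}  e = step (suc-injective e)
  pos⇒arc {path i}  {leafʳ _} e = attachʳ (sym (suc-injective e))
  pos⇒arc {leafʳ _} {y}       e = contradiction (subst (_≤ _) e (pos≤ y)) 1+n≰n

module _ {m : ℕ} where

  -- With a single left leaf, only the top level `suc (suc m)` holds two vertices.
  pos-injective : {x y : DVertex 1 (suc m) 2} → pos x ≡ pos y → pos x ≤ suc m → x ≡ y
  pos-injective {leafˡ zero} {leafˡ zero} _ _ = refl
  pos-injective {path i}     {path j}     e _ = cong path (toℕ-injective (suc-injective e))
  pos-injective {path i}     {leafʳ _}    e ≤m = contradiction (subst (_≤ suc m) e ≤m) 1+n≰n
  pos-injective {leafʳ _}                 _ ≤m = contradiction ≤m 1+n≰n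

  pos-surjective : ∀ {k} → k ≤ suc (suc m) → ∃[ x ] pos {1} {suc m} {2} x ≡ k
  pos-surjective {zero}  _         = leafˡ zero , refl
  pos-surjective {suc k} (s≤s k≤) with m≤n⇒m<n∨m≡n k≤
  ... | inj₁ k<   = path (fromℕ< k<) , cong suc (toℕ-fromℕ< k<)
  ... | inj₂ refl = leafʳ zero , refl

-- The fork of `D 1 n 2` at its degree-3 vertex, for `n ≢ 3`.

module _ {m : ℕ} (m≢2 : m ≢ 2) {K : SimpleGraph V} (iso : K ≅ D 1 (suc m) 2) where
  open SimpleGraph K
  open _≅_ iso
  open Inverse bijection using (from; strictlyInverseˡ; strictlyInverseʳ)

  private
    level : V → ℕ
    level x = pos (to x)

    level≤ : ∀ x → level x ≤ suc (suc m)
    level≤ x = pos≤ (to x)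

    level-injective : ∀ {x y} → level x ≡ level y → level x ≤ suc m → x ≡ y
    level-injective e ≤m =
      trans (sym (strictlyInverseʳ _)) (trans (cong from (pos-injective e ≤m)) (strictlyInverseʳ _))

    level-from : ∀ d → level (from d) ≡ pos d
    level-from d = cong pos (strictlyInverseˡ d)

    level-surjective : ∀ {k} → k ≤ suc (suc m) → ∃[ x ] level x ≡ k
    level-surjective k≤ with d , e ← pos-surjective k≤ = from d , trans (level-from d) e

    ~⇒level : ∀ {x y} → x ~ y → level y ≡ suc (level x) ⊎ level x ≡ suc (level y)
    ~⇒level {x} {y} x~y with Equivalence.to (adjacency x y) x~y
    ... | fwd a = inj₁ (arc⇒pos a)
    ... | bwd a = inj₂ (arc⇒pos a)

    up : ∀ {x y} → level y ≡ suc (level x) → x ~ y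
    up {x} {y} e = Equivalence.from (adjacency x y) (fwd (pos⇒arc e))

    centre : V
    centre = from (path (fromℕ m))

    level-centre : level centre ≡ suc m
    level-centre = trans (level-from _) (cong suc (toℕ-fromℕ m))

    level⇒centre : ∀ {x} → level x ≡ suc m → x ≡ centre
    level⇒centre e = level-injective (trans e (sym level-centre)) (≤-reflexive e)

    top : Fin 2 → V
    top b = from (leafʳ b)

    centre~top : ∀ b → centre ~ top b
    centre~top b = up (trans (level-from _) (cong suc (sym level-centre)))

    top-leaf : ∀ {x} → level x ≡ suc (suc m) → ∀ z → x ~ z → z ≡ centre
    top-leaf e z x~z with ~⇒level x~z
    ... | inj₁ z-above = contradiction (subst (_≤ _) (trans z-above (cong suc e)) (level≤ z)) 1+n≰n
    ... | inj₂ z-below = level⇒centre (suc-injective (trans (sym z-below) e))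

    centre-neighbour : ∀ {x} → centre ~ x → level x ≡ suc (suc m) ⊎ level x ≡ m
    centre-neighbour c~x with ~⇒level c~x
    ... | inj₁ e = inj₁ (trans e (cong suc level-centre))
    ... | inj₂ e = inj₂ (suc-injective (trans (sym e) level-centre))

    -- Distinct vertices share a level only at the top, where the centre is the sole neighbour.
    twins : ∀ {x p q} → x ~ p → p ≢ q → level p ≡ level q → x ≡ centre
    twins {p = p} x~p p≢q e with m≤n⇒m<n∨m≡n (level≤ p)
    ... | inj₁ p<    = contradiction (level-injective e (≤-pred p<)) p≢q
    ... | inj₂ p-top = top-leaf p-top _ (~-sym x~p)

  forked : Forked K centre
  forked = record
    { c~n₁        = centre~top zero
    ; c~n₂        = centre~top (suc zero)
    ; c~n₃        = ~-sym (up (trans level-centre (cong suc (sym lower-level))))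
    ; n₁≢n₂       = top-≢
    ; n₁≢n₃       = top≢lower zero
    ; n₂≢n₃       = top≢lower (suc zero)
    ; leaf        = leaf
    ; nonisolated = nonisolated
    ; degree≥3    = degree≥3
    ; extend      = extend
    }
    where
    -- Level `m` holds the left leaf if `m` is 0 and a path vertex otherwise.
    lower : V
    lower = proj₁ (level-surjective (m≤n+m m 2))

    lower-level : level lower ≡ m
    lower-level = proj₂ (level-surjective (m≤n+m m 2))

    top-≢ : top zero ≢ top (suc zero)
    top-≢ e with () ← trans (sym (strictlyInverseˡ _)) (trans (cong to e) (strictlyInverseˡ _))

    top≢lower : ∀ b → top b ≢ lower
    top≢lower b e =
      m≢1+n+m m (trans (sym lower-level) (trans (cong level (sym e)) (level-from _)))

    -- Only one neighbour of the centre lies below it; those above are leaves.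
    leaf : ∀ {x y} → centre ~ x → centre ~ y → x ≢ y →
           (∀ z → x ~ z → z ≡ centre) ⊎ (∀ z → y ~ z → z ≡ centre)
    leaf c~x c~y x≢y with centre-neighbour c~x | centre-neighbour c~y
    ... | inj₁ x-top | _          = inj₁ (top-leaf x-top)
    ... | inj₂ _     | inj₁ y-top = inj₂ (top-leaf y-top)
    ... | inj₂ x-low | inj₂ y-low = contradiction
      (level-injective (trans x-low (sym y-low)) (subst (_≤ _) (sym x-low) (n≤1+n m))) x≢y

    nonisolated : ∀ x → ∃[ y ] x ~ y
    nonisolated x with m≤n⇒m<n∨m≡n (level≤ x)
    ... | inj₁ x<    = _ , up (proj₂ (level-surjective x<))
    ... | inj₂ x-top = centre , ~-sym (up (trans x-top (cong suc (sym level-centre))))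

    -- Neighbours lie one level up or one level down, so two of any three are on the same level.
    degree≥3 : ∀ {x p q r} → x ~ p → x ~ q → x ~ r → p ≢ q → p ≢ r → q ≢ r → x ≡ centre
    degree≥3 {x} {p} {q} {r} x~p x~q x~r p≢q p≢r q≢r
      with ~⇒level x~p | ~⇒level x~q | ~⇒level x~r
    ... | inj₁ a | inj₁ b | _      = twins x~p p≢q (trans a (sym b))
    ... | inj₁ a | inj₂ _ | inj₁ b = twins x~p p≢r (trans a (sym b))
    ... | inj₁ _ | inj₂ a | inj₂ b = twins x~q q≢r (suc-injective (trans (sym a) b))
    ... | inj₂ _ | inj₁ a | inj₁ b = twins x~q q≢r (trans a (sym b))
    ... | inj₂ a | inj₁ _ | inj₂ b = twins x~p p≢r (suc-injective (trans (sym a) b))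
    ... | inj₂ a | inj₂ b | _      = twins x~p p≢q (suc-injective (trans (sym a) b))

    -- The walk cannot turn back, so it descends, and `s` can be taken one level below `r`.
    extend : ∀ {p q r} → centre ~ p → p ~ q → q ≢ centre → q ~ r → r ≢ p → ∃[ s ] r ~ s × s ≢ q
    extend {p} {q} {r} c~p p~q q≢c q~r r≢p
      with centre-neighbour c~p | ~⇒level p~q | ~⇒level q~r
    ... | inj₁ p-top | _        | _        = contradiction (top-leaf p-top q p~q) q≢c
    ... | inj₂ p-low | inj₁ q-up | _        =
      contradiction (level⇒centre (trans q-up (cong suc p-low))) q≢c
    ... | inj₂ p-low | inj₂ q-down | inj₁ r-up = contradiction
      (sym (level-injective (trans q-down (sym r-up)) (subst (_≤ _) (sym p-low) (n≤1+n m)))) r≢p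
    ... | inj₂ p-low | inj₂ q-down | inj₂ r-down with level r in r-level
    -- Here `p`, `q`, `r` would be on levels 2, 1, 0 and `p` on level `m`.
    ...   | zero  = contradiction (trans (sym p-low) (trans q-down (cong suc r-down))) m≢2
    ...   | suc j with s , s-level ← level-surjective {j}
                         (≤-trans (n≤1+n j) (subst (_≤ _) r-level (level≤ r))) =
      s , ~-sym (up (trans r-level (cong suc (sym s-level)))) ,
      λ { refl → m≢1+n+m j {1} (trans (sym s-level) r-down) }

-- The case `n ≡ 3`: a graph realising `D 1 3 2`.

-- The complement of G₆ is a triangle with a pendant edge at one corner and a
-- pendant path of length two at another.

ends : DVertex 1 3 2 → Fin 6 × Fin 6
-- In the letters of the general argument, `x`, `y`, `u`, `v`, `z` are 0, 1, 2, 3, 4: the path `xy`,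
-- `xu`, `uz`, `uv` stops at the left leaf.
ends (leafˡ zero)          = # 2 , # 3
ends (path zero)           = # 2 , # 4
ends (path (suc zero))     = # 0 , # 2
ends (path (suc (suc i)))  = # 0 , # 1
ends (leafʳ zero)          = # 0 , # 3
ends (leafʳ (suc i))       = # 1 , # 5

edge : DVertex 1 3 2 → Subset 6
edge d = pair (proj₁ (ends d)) (proj₂ (ends d))

_≟ˢ_ : DecidableEquality (Subset k)
_≟ˢ_ = ≡-dec _≟ᵇ_

enumerate : Fin 6 → DVertex 1 3 2
enumerate zero                                = leafˡ zero
enumerate (suc zero)                          = path zero
enumerate (suc (suc zero))                    = path (suc zero)
enumerate (suc (suc (suc zero)))              = path (suc (suc zero))
enumerate (suc (suc (suc (suc zero))))        = leafʳ zero
enumerate (suc (suc (suc (suc (suc zero)))))  = leafʳ (suc zero)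

index : DVertex 1 3 2 → Fin 6
index (leafˡ zero)    = # 0
index (path i)        = suc (i ↑ˡ 2)
index (leafʳ i)       = 4 ↑ʳ i

enumerate-index : ∀ d → enumerate (index d) ≡ d
enumerate-index (leafˡ zero)             = refl
enumerate-index (path zero)              = refl
enumerate-index (path (suc zero))        = refl
enumerate-index (path (suc (suc zero)))  = refl
enumerate-index (leafʳ zero)             = refl
enumerate-index (leafʳ (suc zero))       = refl

-- Makes statements about all six vertices decidable, so that the checks below are done by
-- evaluation.
all-DVertex? : {P : DVertex 1 3 2 → Set} → (∀ d → Dec (P d)) → Dec (∀ d → P d)
all-DVertex? {P} P? =
  map′ (λ f d → subst P (enumerate-index d) (f (index d))) (λ f i → f (enumerate i))
       (all? (P? ∘ enumerate))

_≟ᴰ_ : DecidableEquality (DVertex 1 3 2)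
d ≟ᴰ e = map′ (λ i≡j → trans (sym (enumerate-index d)) (trans (cong enumerate i≡j) (enumerate-index e)))
              (cong index) (index d ≟ᶠ index e)

G₆ : SimpleGraph (Fin 6)
G₆ = record
  { _~_      = λ a b → a ≢ b × ∀ d → edge d ≢ pair a b
  ; ~-sym    = λ {a} {b} (a≢b , no-edge) →
      ≢-sym a≢b , λ d e → no-edge d (trans e (∪-comm ⁅ b ⁆ ⁅ a ⁆))
  ; ~-irrefl = λ a≡b (a≢b , _) → a≢b a≡b
  ; _~?_     = λ a b → ¬? (a ≟ᶠ b) ×-dec all-DVertex? λ d → ¬? (edge d ≟ˢ pair a b)
  }

pair-≡ : {a b u v : Fin k} → u ∈ pair a b → v ∈ pair a b → u ≢ v → pair a b ≡ pair u v
pair-≡ {a = a} {b} u∈ v∈ u≢v with ∈pair⁻ u∈ | ∈pair⁻ v∈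
... | inj₁ refl | inj₁ refl = contradiction refl u≢v
... | inj₁ refl | inj₂ refl = refl
... | inj₂ refl | inj₁ refl = ∪-comm ⁅ a ⁆ ⁅ b ⁆
... | inj₂ refl | inj₂ refl = contradiction refl u≢v

∣edge∣≡2 : ∀ d → ∣ edge d ∣ ≡ 2
∣edge∣≡2 = from-yes (all-DVertex? λ d → ∣ edge d ∣ ≟ⁿ 2)

edge-node : DVertex 1 3 2 → TS₂-Node G₆
edge-node d = edge d , [ ∣edge∣≡2 d , (λ u∈ v∈ (u≢v , no-edge) → no-edge d (pair-≡ u∈ v∈ u≢v)) ]

edge-injective : ∀ d e → edge d ≡ edge e → d ≡ e
edge-injective =
  from-yes (all-DVertex? λ d → all-DVertex? λ e → (edge d ≟ˢ edge e) →-dec (d ≟ᴰ e))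

edge-node-surjective : ∀ I → ∃[ d ] edge-node d ≡ I
edge-node-surjective I with a , b , a≁b@(a≢b , ¬a~b) , refl ← ⟨⟩-surjective {G = G₆} I
  -- Being nonadjacent in `G₆` only says that the pair cannot be missing from the list of edges; a
  -- finite search finds the edge itself.
  with any? (λ i → edge (enumerate i) ≟ˢ pair a b)
... | yes (i , e) = enumerate i , node-≡ {G = G₆} e
... | no  ∄edge   = contradiction
  (a≢b , λ d e → ∄edge (index d , trans (cong edge (enumerate-index d)) e)) ¬a~b

open SimpleGraph (TS₂ G₆) using () renaming (_~_ to infix 4 _~ᵀ_; _~?_ to infix 4 _~ᵀ?_)
open SimpleGraph (D 1 3 2) using () renaming (_~_ to infix 4 _~ᴰ_; _~?_ to infix 4 _~ᴰ?_)

edge-adjacency : ∀ d e → (edge-node d ~ᵀ edge-node e → d ~ᴰ e) × (d ~ᴰ e → edge-node d ~ᵀ edge-node e)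
edge-adjacency = from-yes (all-DVertex? λ d → all-DVertex? λ e →
  let adjᵀ = edge-node d ~ᵀ? edge-node e
      adjᴰ = d ~ᴰ? e
  in (adjᵀ →-dec adjᴰ) ×-dec (adjᴰ →-dec adjᵀ))

TS₂-G₆≅D : TS₂ G₆ ≅ D 1 3 2
TS₂-G₆≅D = record
  { bijection = mk↔ₛ′ label edge-node
      (λ d → edge-injective _ _ (cong value (edge-node-label (edge-node d)))) edge-node-label
  ; adjacency = λ I J → subst₂ (λ I′ J′ → I′ ~ᵀ J′ ⇔ label I ~ᴰ label J)
      (edge-node-label I) (edge-node-label J)
      (let to , from = edge-adjacency (label I) (label J) in mk⇔ to from)
  }
  where
  label : TS₂-Node G₆ → DVertex 1 3 2
  label I = proj₁ (edge-node-surjective I)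

  edge-node-label : ∀ I → edge-node (label I) ≡ I
  edge-node-label I = proj₂ (edge-node-surjective I)

proposition29 : (n : ℕ) → 1 ≤ n → IsTS₂Graph (D 1 n 2) ⇔ n ≡ 3
proposition29 (suc m) _ = mk⇔ only-3 λ { refl → 6 , G₆ , TS₂-G₆≅D }
  where
  only-3 : IsTS₂Graph (D 1 (suc m) 2) → suc m ≡ 3
  only-3 (_ , G , iso) with m ≟ⁿ 2
  ... | yes refl = refl
  ... | no  m≢2  = contradiction (forked m≢2 iso) (TS₂-not-forked {G = G})
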